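{- For any $n$, any $k<n$, and any finite alphabet $\Sigma$ of size $q=|\Sigma|\ge 2$, there is a deterministic encoding algorithm which maps every input string $X\in\Sigma^n$ to a systematic codeword $C(X)\in\Sigma^{n+r}$ consisting of $X$ itself followed by $r=\Theta\!\left(k\frac{\log^2\frac{n}{k}}{\log q}+k\right)$ redundant symbols, and a deterministic decoding algorithm $A_{dec}$ such that for every $X\in\Sigma^n$ and every string $C'$ over $\Sigma$ with $ED(C',C(X))\le k$ we have $A_{dec}(C')=X$.
   Context: $ED(A,B)$ denotes the edit distance between strings $A$ and $B$: the minimum number of single-symbol insertions, deletions, or substitutions transforming one into the other. Logarithms are base two. -}

module Defs where

open import Data.Nat using (ℕ; zero; suc; _+_; _*_; _≤_)
open import Data.Nat.DivMod using (_/_)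
open import Data.Nat.Logarithm using (⌊log₂_⌋; ⌈log₂_⌉)
open import Data.List using (List; _∷_; _++_)

data EditStep {A : Set} : List A → List A → Set where
  ins : ∀ (u v : List A) (a : A) → EditStep (u ++ v) (u ++ a ∷ v)
  del : ∀ (u v : List A) (a : A) → EditStep (u ++ a ∷ v) (u ++ v)
  sub : ∀ (u v : List A) (a b : A) → EditStep (u ++ a ∷ v) (u ++ b ∷ v)

data EditDistLe {A : Set} : ℕ → List A → List A → Set where
  done : ∀ {k xs} → EditDistLe k xs xs
  step : ∀ {k xs ys zs} → EditStep xs ys → EditDistLe k ys zs → EditDistLe (suc k) xs zs

-- ceiling of n / k (defined as 0 when k = 0; only used multiplied by k)
ceilDiv : ℕ → ℕ → ℕ
ceilDiv n zero = 0
ceilDiv n (suc k) = (n + k) / suc k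

logRatio : ℕ → ℕ → ℕ
logRatio n k = ⌈log₂ ceilDiv n k ⌉

logq : ℕ → ℕ
logq q = ⌊log₂ q ⌋

-- The quantity  k · log²(n/k) / log q + k,  multiplied through by log q:
--   k · log²(n/k) + k · log q
scaledBound : ℕ → ℕ → ℕ → ℕ
scaledBound n k q = k * (logRatio n k * logRatio n k) + k * logq q

{-# OPTIONS --safe #-}

-- No efficiency is asked of the algorithms, so a Gilbert–Varshamov argument applies. If a received
-- string is within k edits of X·e and of X′·e′, then X, X′ and also e, e′ differ by at most 8k
-- insertions and deletions. Hence it suffices to choose the redundancies e(X) greedily so that e(X)
-- lies outside the 8k-ball of e(X′) for each X′ in the 8k-ball of X. A ball around a string of
-- length at most k·M is covered by edit scripts of 9k + 1 instructions "copy at most M symbols, then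
-- do nothing, delete or insert", since at most k copies of a full block of M symbols are needed
-- besides the edits; so it has at most ((q + 2)(M + 1))^(9k+1) elements. With
-- M = 2⁹ · 4^log(n/k) the product of two such balls is smaller than q^r.
module Submission where

open import Defs
open import Algebra.Properties.CommutativeSemigroup using (x∙yz≈y∙xz)
open import Data.Fin as Fin using (Fin; funToFin; finToFun)
open import Data.Fin.Properties as Finₚ using (pigeonhole; ¬∀⟶∃¬; funToFin-finToFin)
open import Data.List using (List; []; _∷_; _++_; [_]; length; map; concatMap; take; drop; upTo; allFin; cartesianProductWith)
open import Data.List.Membership.Propositional using (_∈_; _∉_; lose)
open import Data.List.Membership.Propositional.Properties using (∈-map⁺; ∈-map⁻; ∈-++⁺ˡ; ∈-++⁺ʳ; ∈-concatMap⁺; ∈-upTo⁺; ∈-allFin; ∈-cartesianProductWith⁺)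
open import Data.List.Membership.Setoid.Properties using (index-injective)
open import Data.List.Properties using (length-++; length-map; length-upTo; length-tabulate; ≡-dec; ++-cancelʳ)
open import Data.List.Relation.Unary.Any using (here; there; any?; index; satisfied)
open import Data.Nat
open import Data.Nat.DivMod using (m/n≤m; m/n*n≤m; m≡m%n+[m/n]*n; m%n<n; m*n/n≡m; /-monoˡ-≤)
open import Data.Nat.Induction using (<-wellFounded)
open import Data.Nat.Logarithm using (⌈log₂_⌉; ⌈log₂⌉-mono-≤; ⌊log₂_⌋; ⌊log₂⌋-mono-≤; ⌊log₂[2^n]⌋≡n)
open import Data.Nat.Logarithm.Core using (⌊log2⌋; ⌈log2⌉)
open import Data.Nat.Properties
open import Data.Nat.Solver using (module +-*-Solver)
open import Data.Product as Product using (Σ; _×_; _,_; proj₁; proj₂; ∃-syntax)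
open import Data.Sum using (inj₁; inj₂)
open import Data.Vec as Vec using (Vec; toList)
open import Data.Vec.Properties using (cast-is-id; lookup∘tabulate; length-toList; toList-injective)
open import Function using (_∘_; _$_)
open import Induction.WellFounded using (Acc; acc)
open import Relation.Binary using (DecidableEquality)
open import Relation.Binary.PropositionalEquality hiding ([_])
open import Relation.Nullary using (¬_; Dec; yes; no; contradiction)
open import Relation.Nullary.Decidable using (map′; _⊎-dec_; _×-dec_)

-- Indel alignments and their composition.

private variable
  A : Set
  d e : ℕ
  xs ys zs : List A

-- Indel alignments of cost at most d; a substitution costs 2.
data Align {A : Set} : ℕ → List A → List A → Set where
  nil  : Align d [] []
  keep : ∀ {x} → Align d xs ys → Align d (x ∷ xs) (x ∷ ys)
  del  : ∀ {x} → Align d xs ys → Align (suc d) (x ∷ xs) ys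
  ins  : ∀ {y} → Align d xs ys → Align (suc d) xs (y ∷ ys)

align-weaken : d ≤ e → Align d xs ys → Align e xs ys
align-weaken d≤e nil = nil
align-weaken d≤e (keep p) = keep (align-weaken d≤e p)
align-weaken (s≤s d≤e) (del p) = del (align-weaken d≤e p)
align-weaken (s≤s d≤e) (ins p) = ins (align-weaken d≤e p)

align-refl : (xs : List A) → Align d xs xs
align-refl [] = nil
align-refl (_ ∷ xs) = keep (align-refl xs)

align-sym : Align d xs ys → Align d ys xs
align-sym nil = nil
align-sym (keep p) = keep (align-sym p)
align-sym (del p) = ins (align-sym p)
align-sym (ins p) = del (align-sym p)

-- Both alignments are read in lockstep along `ys`. Costs add, except that a symbol inserted by the
-- first and deleted by the second cancels.
align-trans : Align d xs ys → Align e ys zs → Align (d + e) xs zs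
align-trans nil q = align-weaken (m≤n+m _ _) q
align-trans (del p) q = del (align-trans p q)
align-trans (keep p) (keep q) = keep (align-trans p q)
align-trans {d = d} {e = suc e} (keep p) (del q) rewrite +-suc d e = del (align-trans p q)
align-trans {d = d} {e = suc e} (keep p) (ins q) rewrite +-suc d e = ins (align-trans (keep p) q)
align-trans (ins p) (keep q) = ins (align-trans p q)
align-trans {e = suc e} (ins {d = d} p) (del q) =
  align-weaken (≤-trans (+-monoʳ-≤ d (n≤1+n e)) (n≤1+n _)) (align-trans p q)
align-trans {e = suc e} (ins {d = d} p) (ins q) rewrite +-suc d e = ins (align-trans (ins p) q)

align-prepend : (us : List A) → Align d xs ys → Align d (us ++ xs) (us ++ ys)
align-prepend [] p = p
align-prepend (_ ∷ us) p = keep (align-prepend us p)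

align-[] : (xs : List A) → length xs ≤ d → Align d [] xs
align-[] [] _ = nil
align-[] (_ ∷ xs) (s≤s h) = ins (align-[] xs h)

align-drop : (us : List A) {xs : List A} → Align (length us) xs (us ++ xs)
align-drop [] = align-refl _
align-drop (_ ∷ us) = ins (align-drop us)

editStep⇒align : EditStep xs ys → Align 2 xs ys
editStep⇒align (ins u v a) = align-prepend u (ins (align-refl v))
editStep⇒align (del u v a) = align-prepend u (del (align-refl v))
editStep⇒align (sub u v a b) = align-prepend u (del (ins (align-refl v)))

editDist⇒align : ∀ {k} → EditDistLe k xs ys → Align (k * 2) xs ys
editDist⇒align done = align-refl _
editDist⇒align (step s p) = align-trans (editStep⇒align s) (editDist⇒align p)

-- The decoder tests this relation instead of `EditDistLe`: an alignment has no intermediate strings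
-- to guess, so comparing the heads decides it.
align? : DecidableEquality A → ∀ d (xs ys : List A) → Dec (Align d xs ys)
align? _≟A_ d [] [] = yes nil
align? _≟A_ zero [] (y ∷ ys) = no λ ()
align? _≟A_ (suc d) [] (y ∷ ys) = map′ ins (λ { (ins p) → p }) (align? _≟A_ d [] ys)
align? _≟A_ zero (x ∷ xs) [] = no λ ()
align? _≟A_ (suc d) (x ∷ xs) [] = map′ del (λ { (del p) → p }) (align? _≟A_ d xs [])
align? _≟A_ zero (x ∷ xs) (y ∷ ys) =
  map′ (λ { (refl , p) → keep p }) (λ { (keep p) → refl , p }) (x ≟A y ×-dec align? _≟A_ zero xs ys)
align? _≟A_ (suc d) (x ∷ xs) (y ∷ ys) =
  map′ (λ { (inj₁ (refl , p)) → keep p ; (inj₂ (inj₁ p)) → del p ; (inj₂ (inj₂ p)) → ins p })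
       (λ { (keep p) → inj₁ (refl , p) ; (del p) → inj₂ (inj₁ p) ; (ins p) → inj₂ (inj₂ p) })
       ((x ≟A y ×-dec align? _≟A_ (suc d) xs ys)
         ⊎-dec align? _≟A_ d xs (y ∷ ys) ⊎-dec align? _≟A_ d (x ∷ xs) ys)

-- Splitting an alignment of concatenations.

private
  -- An edit is charged twice: once for itself, once for the unit by which the slack grows.
  del-slack : ∀ s d → suc (suc s + d * 2) ≡ s + suc d * 2
  del-slack s d = sym (trans (+-suc s (suc (d * 2))) (cong suc (+-suc s (d * 2))))

-- The slack s absorbs the length difference, which each insertion or deletion
-- changes by at most one.
align-prefix : ∀ (xs ys : List A) {us vs} s → length xs ≤ s + length ys → length ys ≤ s + length xs →
               Align d (xs ++ us) (ys ++ vs) → Align (s + d * 2) xs ys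
align-prefix {d = d} [] ys s _ h p = align-[] ys (≤-trans h (≤-trans (≤-reflexive (+-identityʳ s)) (m≤m+n s _)))
align-prefix {d = d} xs@(_ ∷ _) [] s h _ p = align-sym (align-[] xs (≤-trans h (≤-trans (≤-reflexive (+-identityʳ s)) (m≤m+n s _))))
align-prefix (x ∷ xs) (y ∷ ys) s h₁ h₂ (keep p)
  rewrite +-suc s (length xs) | +-suc s (length ys) = keep (align-prefix xs ys s (s≤s⁻¹ h₁) (s≤s⁻¹ h₂) p)
align-prefix (x ∷ xs) ys@(_ ∷ _) s h₁ h₂ (del {d = d} p) = align-weaken (≤-reflexive (del-slack s d)) $
  del (align-prefix xs ys (suc s) (≤-trans (n≤1+n _) (≤-trans h₁ (n≤1+n _))) (≤-trans h₂ (≤-reflexive (+-suc s _))) p)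
align-prefix xs@(_ ∷ _) (y ∷ ys) s h₁ h₂ (ins {d = d} p) = align-weaken (≤-reflexive (del-slack s d)) $
  ins (align-prefix xs ys (suc s) (≤-trans h₁ (≤-reflexive (+-suc s _))) (≤-trans (n≤1+n _) (≤-trans h₂ (n≤1+n _))) p)

-- The same walk as in `align-prefix`, discarding the edits met on the way. When one string runs
-- out, at most `s` symbols of the other remain, and cutting them off costs at most `s`.
align-suffix : ∀ (xs ys : List A) {us vs} s → length xs ≤ s + length ys → length ys ≤ s + length xs →
               Align d (xs ++ us) (ys ++ vs) → Align (s + d * 2) us vs
align-suffix {d = d} [] ys s _ h p =
  align-weaken (≤-trans (≤-reflexive (+-comm d _)) (+-mono-≤ (≤-trans h (≤-reflexive (+-identityʳ s))) (m≤m*n d 2)))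
    (align-trans p (align-sym (align-drop ys)))
align-suffix {d = d} xs@(_ ∷ _) [] s h _ p =
  align-weaken (+-mono-≤ (≤-trans h (≤-reflexive (+-identityʳ s))) (m≤m*n d 2)) (align-trans (align-drop xs) p)
align-suffix (x ∷ xs) (y ∷ ys) s h₁ h₂ (keep p)
  rewrite +-suc s (length xs) | +-suc s (length ys) = align-suffix xs ys s (s≤s⁻¹ h₁) (s≤s⁻¹ h₂) p
align-suffix (x ∷ xs) ys@(_ ∷ _) s h₁ h₂ (del {d = d} p) = align-weaken (≤-trans (n≤1+n _) (≤-reflexive (del-slack s d))) $
  align-suffix xs ys (suc s) (≤-trans (n≤1+n _) (≤-trans h₁ (n≤1+n _))) (≤-trans h₂ (≤-reflexive (+-suc s _))) p
align-suffix xs@(_ ∷ _) (y ∷ ys) s h₁ h₂ (ins {d = d} p) = align-weaken (≤-trans (n≤1+n _) (≤-reflexive (del-slack s d))) $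
  align-suffix xs ys (suc s) (≤-trans h₁ (≤-reflexive (+-suc s _))) (≤-trans (n≤1+n _) (≤-trans h₂ (n≤1+n _))) p

-- Covering balls by edit scripts.

length-concatMap-≤ : ∀ {A B : Set} (f : A → List B) {c} (xs : List A) →
                     (∀ x → length (f x) ≤ c) → length (concatMap f xs) ≤ length xs * c
length-concatMap-≤ f [] h = z≤n
length-concatMap-≤ f (x ∷ xs) h =
  ≤-trans (≤-reflexive (length-++ (f x))) (+-mono-≤ (h x) (length-concatMap-≤ f xs h))

-- scripts t m xs lists the results of the edit scripts of t instructions on xs. An instruction
-- copies at most M symbols and then does nothing, deletes a symbol, or inserts one; the first
-- instruction copies exactly m symbols.
module Scripts (q M : ℕ) where

  mutual
    scripts : ℕ → ℕ → List (Fin q) → List (List (Fin q))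
    scripts zero m xs = [ xs ]
    scripts (suc t) m xs = map (take m xs ++_) (edits t (drop m xs))

    edits : ℕ → List (Fin q) → List (List (Fin q))
    edits t xs = anyScript t xs ++ anyScript t (drop 1 xs)
              ++ concatMap (λ a → map (a ∷_) (anyScript t xs)) (allFin q)

    anyScript : ℕ → List (Fin q) → List (List (Fin q))
    anyScript t xs = concatMap (λ m → scripts t m xs) (upTo (suc M))

  -- Choices per instruction: do nothing, delete, or insert one of `q` symbols, and then one of
  -- `suc M` copy lengths for what follows.
  base : ℕ
  base = (2 + q) * suc M

  length-scripts : ∀ t m xs → length (scripts t m xs) ≤ base ^ t
  length-anyScript : ∀ t xs → length (anyScript t xs) ≤ suc M * base ^ t

  length-scripts zero m xs = ≤-refl
  length-scripts (suc t) m xs = begin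
    length (map (take m xs ++_) (edits t rest))
      ≡⟨ length-map _ (edits t rest) ⟩
    length (edits t rest)
      ≡⟨ trans (length-++ (anyScript t rest)) (cong (length (anyScript t rest) +_) (length-++ (anyScript t (drop 1 rest)))) ⟩
    length (anyScript t rest) + (length (anyScript t (drop 1 rest)) + length inserted)
      ≤⟨ +-mono-≤ (length-anyScript t rest) (+-mono-≤ (length-anyScript t (drop 1 rest)) inserted-≤) ⟩
    (2 + q) * (suc M * base ^ t)
      ≡⟨ *-assoc (2 + q) (suc M) (base ^ t) ⟨
    base ^ suc t ∎
    where
    open ≤-Reasoning
    rest = drop m xs
    inserted = concatMap (λ a → map (a ∷_) (anyScript t rest)) (allFin q)
    inserted-≤ : length inserted ≤ q * (suc M * base ^ t)
    inserted-≤ = begin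
      length inserted
        ≤⟨ length-concatMap-≤ _ (allFin q) (λ a → ≤-trans (≤-reflexive (length-map (a ∷_) (anyScript t rest))) (length-anyScript t rest)) ⟩
      length (allFin q) * (suc M * base ^ t)
        ≡⟨ cong (_* (suc M * base ^ t)) (length-tabulate {n = q} (λ i → i)) ⟩
      q * (suc M * base ^ t) ∎

  length-anyScript t xs =
    ≤-trans (length-concatMap-≤ (λ m → scripts t m xs) (upTo (suc M)) (λ m → length-scripts t m xs))
            (≤-reflexive (cong (_* base ^ t) (length-upTo (suc M))))

  module _ (t : ℕ) (xs : List (Fin q)) {m : ℕ} {ys : List (Fin q)} where

    ∈-anyScript : m ≤ M → ys ∈ scripts t m xs → ys ∈ anyScript t xs
    ∈-anyScript m≤M p = ∈-concatMap⁺ _ (lose (∈-upTo⁺ (s≤s m≤M)) p)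

    -- Doing nothing serves to break up runs of more than `M` kept symbols and to pad scripts to a
    -- common length.
    ∈-scripts-noop : m ≤ M → ys ∈ scripts t m xs → ys ∈ scripts (suc t) 0 xs
    ∈-scripts-noop m≤M p = ∈-map⁺ _ (∈-++⁺ˡ (∈-anyScript m≤M p))

    ∈-scripts-del : ∀ {x} → m ≤ M → ys ∈ scripts t m xs → ys ∈ scripts (suc t) 0 (x ∷ xs)
    ∈-scripts-del {x} m≤M p = ∈-map⁺ _ (∈-++⁺ʳ (anyScript t (x ∷ xs)) (∈-++⁺ˡ (∈-anyScript m≤M p)))

    ∈-scripts-ins : ∀ {y} → m ≤ M → ys ∈ scripts t m xs → y ∷ ys ∈ scripts (suc t) 0 xs
    ∈-scripts-ins {y} m≤M p = ∈-map⁺ _ $ ∈-++⁺ʳ (anyScript t xs) $ ∈-++⁺ʳ (anyScript t (drop 1 xs)) $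
      ∈-concatMap⁺ _ (lose (∈-allFin y) (∈-map⁺ (y ∷_) (∈-anyScript m≤M p)))

  -- A kept symbol lengthens the first copy and costs no instruction. At `t = 0` the whole rest is
  -- copied, whatever `m` is.
  ∈-scripts-keep : ∀ t m xs {ys x} → ys ∈ scripts t m xs → x ∷ ys ∈ scripts t (suc m) (x ∷ xs)
  ∈-scripts-keep zero m xs (here refl) = here refl
  ∈-scripts-keep (suc t) m xs p with _ , z∈ , refl ← ∈-map⁻ _ p = ∈-map⁺ _ z∈

  -- The one instruction beyond `j` resets the first copy length to 0, so that a single list covers
  -- the ball.
  ∈-scripts-pad : ∀ t xs {m ys} j → m ≤ M → ys ∈ scripts t m xs → ys ∈ scripts (suc j + t) 0 xs
  ∈-scripts-pad t xs zero m≤M p = ∈-scripts-noop t xs m≤M p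
  ∈-scripts-pad t xs (suc j) m≤M p = ∈-scripts-noop (suc j + t) xs z≤n (∈-scripts-pad t xs j m≤M p)

  -- Besides one instruction per edit, only f instructions copying a full block of M symbols are needed.
  align⇒script : 1 ≤ M → Align d xs ys →
                 ∃[ f ] ∃[ m ] m ≤ M × f * M + m ≤ length xs × ys ∈ scripts (d + f) m xs
  align⇒script {d = zero} 1≤M nil = 0 , 0 , z≤n , z≤n , here refl
  align⇒script {d = suc d} 1≤M nil with f , m , m≤M , fits , p ← align⇒script {d = d} 1≤M nil =
    f , 0 , z≤n , ≤-trans (+-monoʳ-≤ (f * M) z≤n) fits , ∈-scripts-noop (d + f) [] m≤M p
  align⇒script {d = d} 1≤M (keep {xs = xs} {ys = ys} {x = x} a) with f , m , m≤M , fits , p ← align⇒script 1≤M a | m ≟ M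
  ... | no m≢M = f , suc m , ≤∧≢⇒< m≤M m≢M , ≤-trans (≤-reflexive (+-suc (f * M) m)) (s≤s fits) , ∈-scripts-keep (d + f) m xs p
  -- The block is full: it is counted in `f`, and a new first instruction copies just `x`.
  ... | yes refl = suc f , 1 , 1≤M
                 , ≤-trans (≤-reflexive (trans (+-comm (M + f * M) 1) (cong suc (+-comm M (f * M))))) (s≤s fits)
                 , subst (λ t → x ∷ ys ∈ scripts t 1 (x ∷ xs)) (sym (+-suc d f))
                     (∈-scripts-keep (suc (d + f)) 0 xs (∈-scripts-noop (d + f) xs m≤M p))
  align⇒script 1≤M (del {d = d} {xs = xs} a) with f , m , m≤M , fits , p ← align⇒script 1≤M a =
    f , 0 , z≤n , ≤-trans (+-monoʳ-≤ (f * M) z≤n) (m≤n⇒m≤1+n fits) , ∈-scripts-del (d + f) xs m≤M p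
  align⇒script 1≤M (ins {d = d} {xs = xs} a) with f , m , m≤M , fits , p ← align⇒script 1≤M a =
    f , 0 , z≤n , ≤-trans (+-monoʳ-≤ (f * M) z≤n) fits , ∈-scripts-ins (d + f) xs m≤M p

  -- At most `k` full blocks fit into `k * M` symbols, so `f ≤ k`, and padding by `k ∸ f` gives all
  -- scripts the same length.
  align⇒∈-ball : ∀ k → 1 ≤ M → length xs ≤ k * M → Align d xs ys → ys ∈ scripts (suc (d + k)) 0 xs
  align⇒∈-ball {xs = xs} {d = d} {ys = ys} k 1≤M short a with f , m , m≤M , fits , p ← align⇒script 1≤M a =
    subst (λ t → ys ∈ scripts (suc t) 0 xs) eq (∈-scripts-pad (d + f) xs (k ∸ f) m≤M p)
    where
    f≤k : f ≤ k
    f≤k = *-cancelʳ-≤ f k M {{>-nonZero 1≤M}} (≤-trans (m≤m+n (f * M) m) (≤-trans fits short))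
    eq : (k ∸ f) + (d + f) ≡ d + k
    eq = begin
      (k ∸ f) + (d + f)  ≡⟨ +-comm (k ∸ f) (d + f) ⟩
      d + f + (k ∸ f)    ≡⟨ +-assoc d f (k ∸ f) ⟩
      d + (f + (k ∸ f))  ≡⟨ cong (d +_) (m+[n∸m]≡n f≤k) ⟩
      d + k              ∎
      where open ≡-Reasoning

-- Words of fixed length over a finite alphabet.

module _ {q : ℕ} where

  funToFin-cong : ∀ {r} {f g : Fin r → Fin q} → f ≗ g → funToFin f ≡ funToFin g
  funToFin-cong {zero} h = refl
  funToFin-cong {suc r} h = cong₂ Fin.combine (h Fin.zero) (funToFin-cong (h ∘ Fin.suc))

  nthVec : ∀ r → Fin (q ^ r) → Vec (Fin q) r
  nthVec r i = Vec.tabulate (finToFun i)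

  nthVec-injective : ∀ r {i j} → nthVec r i ≡ nthVec r j → i ≡ j
  nthVec-injective r {i} {j} h = begin
    i                              ≡⟨ funToFin-finToFin {r} i ⟨
    funToFin (finToFun {q} {r} i)  ≡⟨ funToFin-cong same ⟩
    funToFin (finToFun {q} {r} j)  ≡⟨ funToFin-finToFin {r} j ⟩
    j                              ∎
    where
    open ≡-Reasoning
    same : finToFun {q} {r} i ≗ finToFun j
    same x = trans (sym (lookup∘tabulate (finToFun {q} {r} i) x))
                   (trans (cong (λ v → Vec.lookup v x) h) (lookup∘tabulate (finToFun {q} {r} j) x))

  toList-inj : ∀ {r} (v w : Vec (Fin q) r) → toList v ≡ toList w → v ≡ w
  toList-inj v w h = trans (sym (cast-is-id refl v)) (toList-injective refl v w h)

  -- If all `q ^ r` words occurred in `ys`, two of them would share a position by pigeonhole and be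
  -- equal. Decidable membership turns this refutation into a witness.
  fresh : ∀ r (ys : List (List (Fin q))) → length ys < q ^ r → Σ (Vec (Fin q) r) λ v → toList v ∉ ys
  fresh r ys short = Product.map (nthVec r) (λ i∉ → i∉) (¬∀⟶∃¬ (q ^ r) (λ i → word i ∈ ys) (λ i → word i ∈? ys) ¬all)
    where
    open import Data.List.Membership.DecPropositional (≡-dec (Finₚ._≟_ {q})) using (_∈?_)
    word : Fin (q ^ r) → List (Fin q)
    word = toList ∘ nthVec r
    ¬all : ¬ (∀ i → word i ∈ ys)
    ¬all all with i , j , i<j , same ← pigeonhole short (index ∘ all) =
      Finₚ.<⇒≢ i<j (nthVec-injective r (toList-inj _ _ (index-injective (setoid _) (all i) (all j) same)))

  allVecs : ∀ n → List (Vec (Fin q) n)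
  allVecs zero = [ Vec.[] ]
  allVecs (suc n) = cartesianProductWith Vec._∷_ (allFin q) (allVecs n)

  ∈-allVecs : ∀ {n} (v : Vec (Fin q) n) → v ∈ allVecs n
  ∈-allVecs Vec.[] = here refl
  ∈-allVecs (a Vec.∷ v) = ∈-cartesianProductWith⁺ Vec._∷_ (∈-allFin a) (∈-allVecs v)

-- Greedy choice of separated values.

module Greedy {V E K : Set} (_≟V_ : DecidableEquality V) (key : E → K)
              (nbrs : V → List V) (bad : E → List K) {a b N : ℕ}
              (nbrs-≤ : ∀ x → length (nbrs x) ≤ a) (bad-≤ : ∀ e → length (bad e) ≤ b)
              (pick : ∀ ks → length ks < N → Σ E λ e → key e ∉ ks) (ab<N : a * b < N) where

  open import Data.List.Membership.DecPropositional _≟V_ using (_∈?_)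

  -- The contradiction comes from whichever of `x`, `y` was treated later: its neighbours and their
  -- bad lists. Taking both directions as premises makes the property symmetric without symmetry of
  -- `nbrs` or `bad`.
  Separating : List V → (V → E) → Set
  Separating vs f = ∀ {x y} → x ∈ vs → y ∈ vs → x ≢ y → y ∈ nbrs x → x ∈ nbrs y →
                    key (f y) ∈ bad (f x) → key (f x) ∉ bad (f y)

  forbidden : (V → E) → V → List K
  forbidden f x = concatMap (bad ∘ f) (nbrs x)

  ∈-forbidden : ∀ f {x y k} → y ∈ nbrs x → k ∈ bad (f y) → k ∈ forbidden f x
  ∈-forbidden f y∈ k∈ = ∈-concatMap⁺ _ (lose y∈ k∈)

  length-forbidden : ∀ f x → length (forbidden f x) < N
  length-forbidden f x =
    ≤-<-trans (≤-trans (length-concatMap-≤ (bad ∘ f) (nbrs x) (bad-≤ ∘ f)) (*-monoˡ-≤ b (nbrs-≤ x))) ab<N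

  greedy : ∀ vs → Σ (V → E) (Separating vs)
  -- An arbitrary pick is the value outside the list, as `V` may be infinite.
  greedy [] = (λ _ → proj₁ (pick [] (≤-<-trans z≤n ab<N))) , λ ()
  greedy (v ∷ vs) with f , sep ← greedy vs | v ∈? vs
  ... | yes v∈vs = f , λ x∈ y∈ → sep (old x∈) (old y∈)
    where
    old : ∀ {x} → x ∈ v ∷ vs → x ∈ vs
    old (here refl) = v∈vs
    old (there x∈) = x∈
  ... | no v∉vs with e , e∉ ← pick (forbidden f v) (length-forbidden f v) = g , sep′
    where
    g : V → E
    g x with x ≟V v
    ... | yes _ = e
    ... | no _ = f x
    g-new : g v ≡ e
    g-new with v ≟V v
    ... | yes _ = refl
    ... | no v≢v = contradiction refl v≢v
    g-old : ∀ {x} → x ∈ vs → g x ≡ f x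
    g-old {x} x∈ with x ≟V v
    ... | yes refl = contradiction x∈ v∉vs
    ... | no _ = refl
    sep′ : Separating (v ∷ vs) g
    sep′ (here refl) (here refl) x≢y _ _ _ _ = x≢y refl
    sep′ (here refl) (there y∈) _ y∈nx _ _ h rewrite g-new | g-old y∈ = e∉ (∈-forbidden f y∈nx h)
    sep′ (there x∈) (here refl) _ _ x∈ny h _ rewrite g-new | g-old x∈ = e∉ (∈-forbidden f x∈ny h)
    sep′ (there x∈) (there y∈) x≢y p p′ h h′ rewrite g-old x∈ | g-old y∈ = sep x∈ y∈ x≢y p p′ h h′

-- By uniqueness any hit of the search is the right one; `v₀` is returned only when nothing matches.
searchDecoder : ∀ {C V : Set} (vs : List V) → (∀ v → v ∈ vs) → V → {P : C → V → Set} → (∀ c v → Dec (P c v)) →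
                (∀ {c v w} → P c v → P c w → v ≡ w) → Σ (C → V) λ dec → ∀ {c v} → P c v → dec c ≡ v
searchDecoder {C} {V} vs complete v₀ {P} P? unique = dec , correct
  where
  dec : C → V
  dec c with any? (P? c) vs
  ... | yes p = proj₁ (satisfied p)
  ... | no _ = v₀
  correct : ∀ {c v} → P c v → dec c ≡ v
  correct {c} {v} h with any? (P? c) vs
  ... | yes p = unique (proj₂ (satisfied p)) h
  ... | no ¬p = contradiction (lose (complete v) h) ¬p

-- The systematic code.

-- Two alignments of cost `k * 2` meet in the received string, and splitting off the message doubles
-- their total: 8k.
radius : ℕ → ℕ
radius k = (k * 2 + k * 2) * 2

-- One instruction per edit, one per full block, and one that resets the first copy length.
scriptLength : ℕ → ℕ
scriptLength k = suc (radius k + k)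

module _ {n r : ℕ} (q k M : ℕ) (1≤M : 1 ≤ M) (n≤kM : n ≤ k * M) (r≤kM : r ≤ k * M) where
  open Scripts q M

  systematicCode : Fin q → base ^ scriptLength k * base ^ scriptLength k < q ^ r →
                   Σ (Vec (Fin q) n → Vec (Fin q) r) λ enc →
                   Σ (List (Fin q) → Vec (Fin q) n) λ dec →
                     ∀ (X : Vec (Fin q) n) (C′ : List (Fin q)) →
                     EditDistLe k C′ (toList X ++ toList (enc X)) → dec C′ ≡ X
  systematicCode a₀ room = enc , proj₁ decoder , λ X C′ h → proj₂ decoder (editDist⇒align h)
    where
    ball : List (Fin q) → List (List (Fin q))
    ball = scripts (scriptLength k) 0
    words : List (List (Fin q))
    words = map toList (allVecs n)
    -- Messages enter as lists because a ball also contains strings of other lengths; redundancies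
    -- stay vectors of length `r`, compared through `toList`.
    open Greedy (≡-dec Finₚ._≟_) toList ball (ball ∘ toList)
                (length-scripts (scriptLength k) 0) (length-scripts (scriptLength k) 0 ∘ toList) (fresh {q} r) room
    enc : Vec (Fin q) n → Vec (Fin q) r
    enc X = proj₁ (greedy words) (toList X)

    near : ∀ {m} (v w : Vec (Fin q) m) → m ≤ k * M → Align (radius k) (toList v) (toList w) →
           toList w ∈ ball (toList v)
    near v w m≤kM p = align⇒∈-ball k 1≤M (≤-trans (≤-reflexive (length-toList v)) m≤kM) p

    -- Messages have equal length, so the alignment through `c` splits with slack 0 into a message
    -- part and a redundancy part. For distinct messages the greedy choice excludes that both are
    -- within `radius k`.
    separated : ∀ {c} X Y → Align (k * 2) c (toList X ++ toList (enc X)) →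
                Align (k * 2) c (toList Y ++ toList (enc Y)) → toList X ≡ toList Y
    separated {c} X Y p p′ with ≡-dec Finₚ._≟_ (toList X) (toList Y)
    ... | yes eq = eq
    ... | no X≢Y = contradiction (near (enc Y) (enc X) r≤kM (align-sym suf))
                     (proj₂ (greedy words) (∈-map⁺ toList (∈-allVecs X)) (∈-map⁺ toList (∈-allVecs Y)) X≢Y
                       (near X Y n≤kM pre) (near Y X n≤kM (align-sym pre)) (near (enc X) (enc Y) r≤kM suf))
      where
      both : Align (k * 2 + k * 2) (toList X ++ toList (enc X)) (toList Y ++ toList (enc Y))
      both = align-trans (align-sym p) p′
      X≤Y : length (toList X) ≤ length (toList Y)
      X≤Y = ≤-reflexive (trans (length-toList X) (sym (length-toList Y)))
      Y≤X : length (toList Y) ≤ length (toList X)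
      Y≤X = ≤-reflexive (trans (length-toList Y) (sym (length-toList X)))
      pre : Align (radius k) (toList X) (toList Y)
      pre = align-prefix (toList X) (toList Y) 0 X≤Y Y≤X both
      suf : Align (radius k) (toList (enc X)) (toList (enc Y))
      suf = align-suffix (toList X) (toList Y) 0 X≤Y Y≤X both

    decoder : Σ (List (Fin q) → Vec (Fin q) n) λ dec →
              ∀ {c X} → Align (k * 2) c (toList X ++ toList (enc X)) → dec c ≡ X
    decoder = searchDecoder (allVecs n) ∈-allVecs (Vec.replicate n a₀)
                (λ c X → align? Finₚ._≟_ (k * 2) c (toList X ++ toList (enc X)))
                (λ {c} {X} {Y} p p′ → toList-inj X Y (separated X Y p p′))

-- Estimates for logarithms and rounded quotients.

2^⌊log₂n⌋≤n : ∀ n .{{_ : NonZero n}} → 2 ^ ⌊log₂ n ⌋ ≤ n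
2^⌊log₂n⌋≤n (suc n) = go n (<-wellFounded (suc n))
  where
  -- Stated for any accessibility proof, so that the induction can follow the halving recursion of
  -- the logarithm.
  go : ∀ n (rec : Acc _<_ (suc n)) → 2 ^ ⌊log2⌋ (suc n) rec ≤ suc n
  go zero _ = ≤-refl
  go (suc n) (acc rs) = begin
    2 * 2 ^ ⌊log2⌋ (suc ⌊ n /2⌋) _  ≤⟨ *-monoʳ-≤ 2 (go ⌊ n /2⌋ _) ⟩
    2 * suc ⌊ n /2⌋                 ≡⟨ *-suc 2 ⌊ n /2⌋ ⟩
    2 + 2 * ⌊ n /2⌋                 ≤⟨ +-monoʳ-≤ 2 (+-monoʳ-≤ ⌊ n /2⌋ (≤-trans (≤-reflexive (+-identityʳ _)) (⌊n/2⌋≤⌈n/2⌉ n))) ⟩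
    2 + (⌊ n /2⌋ + ⌈ n /2⌉)         ≡⟨ cong (2 +_) (⌊n/2⌋+⌈n/2⌉≡n n) ⟩
    suc (suc n)                     ∎
    where open ≤-Reasoning

n≤2^⌈log₂n⌉ : ∀ n → n ≤ 2 ^ ⌈log₂ n ⌉
n≤2^⌈log₂n⌉ zero = z≤n
n≤2^⌈log₂n⌉ (suc n) = go n (<-wellFounded (suc n))
  where
  go : ∀ n (rec : Acc _<_ (suc n)) → suc n ≤ 2 ^ ⌈log2⌉ (suc n) rec
  go zero _ = ≤-refl
  go (suc n) (acc rs) = begin
    suc (suc n)                     ≡⟨ cong (2 +_) (⌊n/2⌋+⌈n/2⌉≡n n) ⟨
    2 + (⌊ n /2⌋ + ⌈ n /2⌉)         ≤⟨ +-monoʳ-≤ 2 (+-mono-≤ (⌊n/2⌋≤⌈n/2⌉ n) (≤-reflexive (sym (+-identityʳ _)))) ⟩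
    2 + 2 * ⌈ n /2⌉                 ≡⟨ *-suc 2 ⌈ n /2⌉ ⟨
    2 * suc ⌈ n /2⌉                 ≤⟨ *-monoʳ-≤ 2 (go ⌈ n /2⌉ _) ⟩
    2 * 2 ^ ⌈log2⌉ (suc ⌈ n /2⌉) _  ∎
    where open ≤-Reasoning

n<2^[1+⌊log₂n⌋] : ∀ n → n < 2 ^ suc ⌊log₂ n ⌋
n<2^[1+⌊log₂n⌋] n = ≰⇒> λ h → 1+n≰n (≤-trans (≤-reflexive (sym (⌊log₂[2^n]⌋≡n (suc ⌊log₂ n ⌋)))) (⌊log₂⌋-mono-≤ h))

n<2^n : ∀ n → n < 2 ^ n
n<2^n zero = s≤s z≤n
n<2^n (suc n) = +-mono-≤ (m^n>0 2 n) (≤-trans (n<2^n n) (≤-reflexive (sym (+-identityʳ _))))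

m<[1+m/n]*n : ∀ m n .{{_ : NonZero n}} → m < suc (m / n) * n
m<[1+m/n]*n m n = begin-strict
  m                    ≡⟨ m≡m%n+[m/n]*n m n ⟩
  m % n + (m / n) * n  <⟨ +-monoˡ-< _ (m%n<n m n) ⟩
  n + (m / n) * n      ∎
  where open ≤-Reasoning

n≤k*ceilDiv : ∀ n k .{{_ : NonZero k}} → n ≤ k * ceilDiv n k
n≤k*ceilDiv n (suc k) = +-cancelˡ-≤ (suc k) _ _ $ begin
  suc k + n                     ≡⟨ cong suc (+-comm k n) ⟩
  suc (n + k)                   ≤⟨ m<[1+m/n]*n (n + k) (suc k) ⟩
  suc k + ceilDiv n (suc k) * suc k  ≡⟨ cong (suc k +_) (*-comm (ceilDiv n (suc k)) (suc k)) ⟩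
  suc k + suc k * ceilDiv n (suc k)  ∎
  where open ≤-Reasoning

n≤k*2^logRatio : ∀ n k .{{_ : NonZero k}} → n ≤ k * 2 ^ logRatio n k
n≤k*2^logRatio n k = ≤-trans (n≤k*ceilDiv n k) (*-monoʳ-≤ k (n≤2^⌈log₂n⌉ (ceilDiv n k)))

-- From `k < n` the rounded quotient is at least 2. This yields `L ≤ L * L` below, so that the
-- squared logarithm absorbs linear terms.
1≤logRatio : ∀ n k .{{_ : NonZero k}} → k < n → 1 ≤ logRatio n k
1≤logRatio n k@(suc k′) k<n = ⌈log₂⌉-mono-≤ {2} (begin
  2                ≡⟨ m*n/n≡m 2 k ⟨
  2 * k / k        ≤⟨ /-monoˡ-≤ k (≤-trans (≤-reflexive (trans (cong (k +_) (+-identityʳ k)) (+-suc k k′))) (+-monoˡ-≤ k′ k<n)) ⟩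
  (n + k′) / k     ∎)
  where open ≤-Reasoning

-- Choice of parameters and the counting inequality.

module Parameters (n k q : ℕ) (1≤k : 1 ≤ k) (k<n : k < n) (2≤q : 2 ≤ q) where

  private
    L ℓ : ℕ
    L = logRatio n k
    ℓ = logq q

    instance
      k≢0 : NonZero k
      k≢0 = >-nonZero 1≤k

    1≤ℓ : 1 ≤ ℓ
    1≤ℓ = ⌊log₂⌋-mono-≤ 2≤q

    instance
      ℓ≢0 : NonZero ℓ
      ℓ≢0 = >-nonZero 1≤ℓ

    1≤L : 1 ≤ L
    1≤L = 1≤logRatio n k k<n

    -- Redundancy per error up to the factor `2 ^ 9`: `s * ℓ` is at least `L * L` and at least `ℓ`,
    -- but at most their sum.
    s : ℕ
    s = suc (L * L / ℓ)

    L²≤sℓ : L * L ≤ s * ℓ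
    L²≤sℓ = <⇒≤ (m<[1+m/n]*n (L * L) ℓ)

    ℓ≤sℓ : ℓ ≤ s * ℓ
    ℓ≤sℓ = m≤m+n ℓ _

    sℓ≤L²+ℓ : s * ℓ ≤ L * L + ℓ
    sℓ≤L²+ℓ = ≤-trans (+-monoʳ-≤ ℓ (m/n*n≤m (L * L) ℓ)) (≤-reflexive (+-comm ℓ (L * L)))

    -- The redundancy too must fit into `k` blocks of `M` symbols; hence the summand `L + L` in the
    -- exponent of `M`.
    s≤4^L : s ≤ 2 ^ (L + L)
    s≤4^L = begin
      suc (L * L / ℓ)  ≤⟨ s≤s (m/n≤m (L * L) ℓ) ⟩
      suc (L * L)      ≤⟨ s≤s (m≤n+m (L * L) L) ⟩
      suc (L + L * L)  ≤⟨ s≤s (m≤n+m _ L) ⟩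
      suc (L + (L + L * L))  ≡⟨ solve 1 (λ x → con 1 :+ (x :+ (x :+ x :* x)) := (con 1 :+ x) :* (con 1 :+ x)) refl L ⟩
      suc L * suc L    ≤⟨ *-mono-≤ (n<2^n L) (n<2^n L) ⟩
      2 ^ L * 2 ^ L    ≡⟨ ^-distribˡ-+-* 2 L L ⟨
      2 ^ (L + L)      ∎
      where
      open ≤-Reasoning
      open +-*-Solver

  -- 2 ^ 9 exceeds 300, the constant needed in exponent<.
  r M : ℕ
  r = 2 ^ 9 * (k * s)
  M = 2 ^ (9 + (L + L))

  1≤M : 1 ≤ M
  1≤M = m^n>0 2 (9 + (L + L))

  n≤kM : n ≤ k * M
  n≤kM = ≤-trans (n≤k*2^logRatio n k) (*-monoʳ-≤ k (^-monoʳ-≤ 2 (≤-trans (m≤m+n L L) (m≤n+m (L + L) 9))))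

  r≤kM : r ≤ k * M
  r≤kM = begin
    2 ^ 9 * (k * s)            ≡⟨ x∙yz≈y∙xz *-commutativeSemigroup (2 ^ 9) k s ⟩
    k * (2 ^ 9 * s)            ≤⟨ *-monoʳ-≤ k (*-monoʳ-≤ (2 ^ 9) s≤4^L) ⟩
    k * (2 ^ 9 * 2 ^ (L + L))  ≡⟨ cong (k *_) (^-distribˡ-+-* 2 9 (L + L)) ⟨
    k * M                      ∎
    where open ≤-Reasoning

  private
    rℓ≡ : r * ℓ ≡ 2 ^ 9 * (k * (s * ℓ))
    rℓ≡ = trans (*-assoc (2 ^ 9) (k * s) ℓ) (cong (2 ^ 9 *_) (*-assoc k s ℓ))

    bound≡ : scaledBound n k q ≡ k * (L * L + ℓ)
    bound≡ = sym (*-distribˡ-+ k (L * L) ℓ)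

  r-upper : r * ℓ ≤ 2 ^ 9 * scaledBound n k q
  r-upper = begin
    r * ℓ                      ≡⟨ rℓ≡ ⟩
    2 ^ 9 * (k * (s * ℓ))      ≤⟨ *-monoʳ-≤ (2 ^ 9) (*-monoʳ-≤ k sℓ≤L²+ℓ) ⟩
    2 ^ 9 * (k * (L * L + ℓ))  ≡⟨ cong (2 ^ 9 *_) bound≡ ⟨
    2 ^ 9 * scaledBound n k q  ∎
    where open ≤-Reasoning

  r-lower : scaledBound n k q ≤ 2 ^ 9 * (r * ℓ)
  r-lower = begin
    scaledBound n k q          ≡⟨ bound≡ ⟩
    k * (L * L + ℓ)            ≤⟨ *-monoʳ-≤ k (+-mono-≤ L²≤sℓ ℓ≤sℓ) ⟩
    k * (s * ℓ + s * ℓ)        ≡⟨ *-distribˡ-+ k (s * ℓ) (s * ℓ) ⟩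
    k * (s * ℓ) + k * (s * ℓ)  ≡⟨ cong (k * (s * ℓ) +_) (+-identityʳ _) ⟨
    2 * (k * (s * ℓ))          ≤⟨ *-monoˡ-≤ (k * (s * ℓ)) (≤ᵇ⇒≤ 2 (2 ^ 9) _) ⟩
    2 ^ 9 * (k * (s * ℓ))      ≡⟨ rℓ≡ ⟨
    -- This factor is given away so that both bounds share the constant `2 ^ 9`.
    r * ℓ                      ≤⟨ m≤n*m (r * ℓ) (2 ^ 9) ⟩
    2 ^ 9 * (r * ℓ)            ∎
    where open ≤-Reasoning

  open Scripts q M using (base)

  private
    -- `w` bounds the bits per instruction: `2 + ℓ` for the `2 + q` edits, `10 + (L + L)` for the
    -- `suc M` copy lengths.
    w b : ℕ
    w = (2 + ℓ) + (10 + (L + L))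
    b = scriptLength k

    base≤2^w : base ≤ 2 ^ w
    base≤2^w = begin
      (2 + q) * suc M                    ≤⟨ *-mono-≤ 2+q≤ 1+M≤ ⟩
      2 ^ (2 + ℓ) * 2 ^ (10 + (L + L))   ≡⟨ ^-distribˡ-+-* 2 (2 + ℓ) (10 + (L + L)) ⟨
      2 ^ w                              ∎
      where
      open ≤-Reasoning
      2+q≤ : 2 + q ≤ 2 ^ (2 + ℓ)
      2+q≤ = ≤-trans (+-mono-≤ (≤-trans 2≤q (<⇒≤ (n<2^[1+⌊log₂n⌋] q))) (<⇒≤ (n<2^[1+⌊log₂n⌋] q)))
                     (≤-reflexive (cong (2 ^ suc ℓ +_) (sym (+-identityʳ _))))
      1+M≤ : suc M ≤ 2 ^ (10 + (L + L))
      1+M≤ = +-mono-≤ 1≤M (≤-reflexive (sym (+-identityʳ M)))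

    b≤10k : b ≤ 10 * k
    b≤10k = begin
      1 + ((k * 2 + k * 2) * 2 + k)  ≤⟨ +-monoˡ-≤ _ 1≤k ⟩
      k + ((k * 2 + k * 2) * 2 + k)  ≡⟨ solve 1 (λ x → x :+ ((x :* con 2 :+ x :* con 2) :* con 2 :+ x) := con 10 :* x) refl k ⟩
      10 * k                         ∎
      where
      open ≤-Reasoning
      open +-*-Solver

    -- Each of 1, `ℓ` and `L` is at most `s * ℓ`, and they occur 12, 1 and 2 times.
    w≤15sℓ : w ≤ 15 * (s * ℓ)
    w≤15sℓ = begin
      (2 + ℓ) + (10 + (L + L))        ≡⟨ solve 2 (λ x y → (con 2 :+ x) :+ (con 10 :+ (y :+ y)) := x :+ (con 12 :+ con 2 :* y)) refl ℓ L ⟩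
      ℓ + (12 + 2 * L)                ≤⟨ +-mono-≤ ℓ≤sℓ (+-mono-≤ (*-monoʳ-≤ 12 1≤sℓ) (*-monoʳ-≤ 2 L≤sℓ)) ⟩
      s * ℓ + (12 * (s * ℓ) + 2 * (s * ℓ)) ≡⟨ solve 1 (λ x → x :+ (con 12 :* x :+ con 2 :* x) := con 15 :* x) refl (s * ℓ) ⟩
      15 * (s * ℓ)                    ∎
      where
      open ≤-Reasoning
      open +-*-Solver
      1≤sℓ = ≤-trans 1≤ℓ ℓ≤sℓ
      L≤sℓ = ≤-trans (m≤m*n L L {{>-nonZero 1≤L}}) L²≤sℓ

    -- The two balls, around message and redundancy, take at most 15 · 10 · `z` bits each, together
    -- 300 · `z`, against 512 · `z` bits available.
    exponent< : w * b + w * b < ℓ * r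
    exponent< = begin-strict
      w * b + w * b                  ≤⟨ +-mono-≤ wb≤ wb≤ ⟩
      150 * z + 150 * z              ≡⟨ *-distribʳ-+ z 150 150 ⟨
      300 * z                        <⟨ *-monoˡ-< z {{>-nonZero 1≤z}} (<ᵇ⇒< 300 (2 ^ 9) _) ⟩
      2 ^ 9 * z                      ≡⟨ rℓ≡ ⟨
      r * ℓ                          ≡⟨ *-comm r ℓ ⟩
      ℓ * r                          ∎
      where
      open ≤-Reasoning
      open +-*-Solver
      z = k * (s * ℓ)
      1≤z : 1 ≤ z
      1≤z = *-mono-≤ 1≤k (≤-trans 1≤ℓ ℓ≤sℓ)
      wb≤ : w * b ≤ 150 * z
      wb≤ = ≤-trans (*-mono-≤ w≤15sℓ b≤10k)
              (≤-reflexive (solve 2 (λ x y → (con 15 :* x) :* (con 10 :* y) := con 150 :* (y :* x)) refl (s * ℓ) k))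

  room : base ^ b * base ^ b < q ^ r
  room = begin-strict
    base ^ b * base ^ b        ≤⟨ *-mono-≤ base^b≤ base^b≤ ⟩
    2 ^ (w * b) * 2 ^ (w * b)  ≡⟨ ^-distribˡ-+-* 2 (w * b) (w * b) ⟨
    2 ^ (w * b + w * b)        <⟨ ^-monoʳ-< 2 (s≤s (s≤s z≤n)) exponent< ⟩
    2 ^ (ℓ * r)                ≡⟨ ^-*-assoc 2 ℓ r ⟨
    (2 ^ ℓ) ^ r                ≤⟨ ^-monoˡ-≤ r (2^⌊log₂n⌋≤n q {{>-nonZero (≤-trans (s≤s z≤n) 2≤q)}}) ⟩
    q ^ r                      ∎
    where
    open ≤-Reasoning
    base^b≤ : base ^ b ≤ 2 ^ (w * b)
    base^b≤ = ≤-trans (^-monoˡ-≤ b base≤2^w) (≤-reflexive (^-*-assoc 2 w b))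

-- Assembling the cases.

HasCode : (c n k q : ℕ) → Set
HasCode c n k q =
  Σ ℕ λ r →
  (r * logq q ≤ c * scaledBound n k q) ×
  (scaledBound n k q ≤ c * (r * logq q)) ×
  Σ (Vec (Fin q) n → Vec (Fin q) r) λ enc →
  Σ (List (Fin q) → Vec (Fin q) n) λ dec →
  ∀ (X : Vec (Fin q) n) (C′ : List (Fin q)) →
  EditDistLe k C′ (toList X ++ toList (enc X)) → dec C′ ≡ X

-- Both bounds vanish at `k = 0`, so `r = 0`. Only `done` inhabits `EditDistLe 0`, hence the
-- received string is the message itself.
hasCode-noErrors : ∀ c n q → 2 ≤ q → HasCode c n 0 q
hasCode-noErrors c n q 2≤q =
  0 , z≤n , z≤n , (λ _ → Vec.[]) , proj₁ decoder , λ { X C′ done → proj₂ decoder refl }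
  where
  decoder : Σ (List (Fin q) → Vec (Fin q) n) λ dec → ∀ {c X} → c ≡ toList X ++ [] → dec c ≡ X
  decoder = searchDecoder (allVecs n) ∈-allVecs (Vec.replicate n (Fin.fromℕ< (≤-trans (s≤s z≤n) 2≤q)))
              (λ c X → ≡-dec Finₚ._≟_ c (toList X ++ []))
              (λ {c} {X} {Y} p p′ → toList-inj X Y (++-cancelʳ [] _ _ (trans (sym p) p′)))

hasCode-errors : ∀ n k q → 1 ≤ k → k < n → 2 ≤ q → HasCode (2 ^ 9) n k q
hasCode-errors n k q 1≤k k<n 2≤q =
  -- The symbol 0 fills the message that the decoder returns when its search finds nothing.
  r , r-upper , r-lower , systematicCode q k M 1≤M n≤kM r≤kM (Fin.fromℕ< (≤-trans (s≤s z≤n) 2≤q)) room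
  where open Parameters n k q 1≤k k<n 2≤q

theorem3 : Σ ℕ λ c → ∀ (n k q : ℕ) → k < n → 2 ≤ q →
    Σ ℕ λ r →
    (r * logq q ≤ c * scaledBound n k q) ×
    (scaledBound n k q ≤ c * (r * logq q)) ×
    Σ (Vec (Fin q) n → Vec (Fin q) r) λ enc →
    Σ (List (Fin q) → Vec (Fin q) n) λ dec →
    ∀ (X : Vec (Fin q) n) (C′ : List (Fin q)) →
    EditDistLe k C′ (toList X ++ toList (enc X)) → dec C′ ≡ X
theorem3 = 2 ^ 9 , hasCode
  where
  hasCode : ∀ n k q → k < n → 2 ≤ q → HasCode (2 ^ 9) n k q
  hasCode n zero q _ 2≤q = hasCode-noErrors (2 ^ 9) n q 2≤q
  hasCode n k@(suc _) q k<n 2≤q = hasCode-errors n k q (s≤s z≤n) k<n 2≤q
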